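{- Let $k\ge 2$ and let $G$ be a $\Gamma_{\times k,t}$-external graph with $\delta(G)\ge k$. Then for every graph $H$ with $\delta(H)\ge k$, \[ \Gamma_{\times k,t}(G\,\Box\,H)\ge\Gamma_{\times k,t}(G)\cdot\Gamma_{\times k,t}(H). \]
   Context: A set $S\subseteq V(G)$ is a $k$-tuple total dominating set ($k$TDS) of a graph $G$ with $\delta(G)\ge k$ if $|N_G(x)\cap S|\ge k$ for every $x\in V(G)$. The upper $k$-tuple total domination number $\Gamma_{\times k,t}(G)$ is the maximum cardinality of a minimal (with respect to inclusion) $k$TDS of $G$; a minimal $k$TDS of this cardinality is a $\Gamma_{\times k,t}$-set. For $v\in S$, a vertex $v'$ is a $k$-open private neighbor of $v$ with respect to $S$ if $v\in N_G(v')$ and $|N_G(v')\cap S|=k$; it is external if $v'\notin S$. A graph $G$ is $\Gamma_{\times k,t}$-external if it has a $\Gamma_{\times k,t}$-set $S$ such that every vertex of $S$ has an external $k$-open private neighbor with respect to $S$. The Cartesian product $G\,\Box\,H$ has vertex set $V(G)\times V(H)$, with $(g_1,h_1)\sim(g_2,h_2)$ iff either $g_1=g_2$ and $h_1h_2\in E(H)$, or $h_1=h_2$ and $g_1g_2\in E(G)$. -}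

module Defs where

open import Data.Bool using (true; false)
open import Data.Fin using (Fin; remQuot)
open import Data.Fin.Properties using (all?) renaming (_≟_ to _≟ᶠ_)
open import Data.Fin.Subset using (Subset; _∈_; _∉_; _⊂_; _∩_; ∣_∣)
open import Data.Fin.Subset.Properties using (anySubset?; _⊂?_)
open import Data.List using (List; []; _∷_; map; filter; allFin; cartesianProductWith)
open import Data.List.Extrema.Nat using (min; max)
open import Data.Nat using (ℕ; zero; suc; _*_; _≥_; _≥?_)
open import Data.Product using (_×_; _,_; ∃-syntax)
open import Data.Sum using (_⊎_; inj₁; inj₂)
open import Data.Vec using (Vec; tabulate) renaming ([] to []ᵛ; _∷_ to _∷ᵛ_)
open import Function using (_on_)
open import Level using (0ℓ)
open import Relation.Binary using (Rel; Decidable; Symmetric; Irreflexive)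
open import Relation.Binary.PropositionalEquality using (_≡_; refl; sym)
open import Relation.Nullary using (¬_; Dec; does)
open import Relation.Nullary.Decidable using (map′; ¬?; _×-dec_; _⊎-dec_)

private
  variable
    m n : ℕ

-- Finite simple graphs with vertex set Fin n.
record Graph (n : ℕ) : Set₁ where
  infix 4 _~_ _~?_
  field
    _~_      : Rel (Fin n) 0ℓ
    _~?_     : Decidable _~_
    ~-sym    : Symmetric _~_
    ~-irrefl : Irreflexive _≡_ _~_

module _ (G : Graph n) where
  open Graph G

  N : Fin n → Subset n
  N x = tabulate (λ y → does (x ~? y))

  deg : Fin n → ℕ
  deg x = ∣ N x ∣

  -- The first argument of min is its value on the empty list.  Degrees never
  -- exceed n, so for n > 0 it has no effect; the graph without vertices gets
  -- δ = 0, so δ ≥ k with k > 0 rules that graph out.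
  δ : ℕ
  δ = min n (map deg (allFin n))

module _ (k : ℕ) (G : Graph n) where

  IsTDS : Subset n → Set
  IsTDS S = ∀ x → ∣ N G x ∩ S ∣ ≥ k

  IsMinimalTDS : Subset n → Set
  IsMinimalTDS S = IsTDS S × (∀ T → T ⊂ S → ¬ IsTDS T)

  isTDS? : (S : Subset n) → Dec (IsTDS S)
  isTDS? S = all? (λ x → ∣ N G x ∩ S ∣ ≥? k)

  isMinimalTDS? : (S : Subset n) → Dec (IsMinimalTDS S)
  isMinimalTDS? S = isTDS? S ×-dec
    map′ (λ ¬∃ T T⊂S tds → ¬∃ (T , T⊂S , tds))
         (λ { ∀¬ (T , T⊂S , tds) → ∀¬ T T⊂S tds })
         (¬? (anySubset? (λ T → (T ⊂? S) ×-dec isTDS? T)))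

allSubsets : ∀ n → List (Subset n)
allSubsets zero    = []ᵛ ∷ []
allSubsets (suc n) = cartesianProductWith _∷ᵛ_ (true ∷ false ∷ []) (allSubsets n)

-- The upper k-tuple total domination number.  The default value 0 matters only
-- if G has no k-tuple total dominating set, which cannot happen when δ G ≥ k.
Γ : ∀ (k : ℕ) (G : Graph n) → ℕ
Γ {n} k G = max 0 (map ∣_∣ (filter (isMinimalTDS? k G) (allSubsets n)))

module _ (k : ℕ) (G : Graph n) where

  IsΓSet : Subset n → Set
  IsΓSet S = IsMinimalTDS k G S × ∣ S ∣ ≡ Γ k G

  -- v′ is a k-open private neighbor of v with respect to S.
  IsOpenPrivateNeighbor : (S : Subset n) (v v′ : Fin n) → Set
  IsOpenPrivateNeighbor S v v′ = v ∈ N G v′ × ∣ N G v′ ∩ S ∣ ≡ k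

  IsExternalOpenPrivateNeighbor : (S : Subset n) (v v′ : Fin n) → Set
  IsExternalOpenPrivateNeighbor S v v′ = IsOpenPrivateNeighbor S v v′ × v′ ∉ S

  ΓExternal : Set
  ΓExternal = ∃[ S ] (IsΓSet S ×
    (∀ v → v ∈ S → ∃[ v′ ] IsExternalOpenPrivateNeighbor S v v′))

-- The vertices of the Cartesian product are the pairs in Fin m × Fin n, coded
-- as elements of Fin (m * n) through the bijection remQuot.
module _ (G : Graph m) (H : Graph n) where
  private
    module G = Graph G
    module H = Graph H

  BoxAdj : Rel (Fin m × Fin n) 0ℓ
  BoxAdj (g₁ , h₁) (g₂ , h₂) = (g₁ ≡ g₂ × h₁ H.~ h₂) ⊎ (h₁ ≡ h₂ × g₁ G.~ g₂)

  boxAdj? : Decidable BoxAdj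
  boxAdj? (g₁ , h₁) (g₂ , h₂) =
    ((g₁ ≟ᶠ g₂) ×-dec (h₁ H.~? h₂)) ⊎-dec ((h₁ ≟ᶠ h₂) ×-dec (g₁ G.~? g₂))

  boxAdj-sym : Symmetric BoxAdj
  boxAdj-sym (inj₁ (eq , a)) = inj₁ (sym eq , H.~-sym a)
  boxAdj-sym (inj₂ (eq , a)) = inj₂ (sym eq , G.~-sym a)

  boxAdj-irrefl : Irreflexive _≡_ BoxAdj
  boxAdj-irrefl refl (inj₁ (_ , a)) = H.~-irrefl refl a
  boxAdj-irrefl refl (inj₂ (_ , a)) = G.~-irrefl refl a

  infixr 7 _□_
  _□_ : Graph (m * n)
  _□_ = record
    { _~_      = BoxAdj on remQuot n
    ; _~?_     = λ x y → boxAdj? (remQuot n x) (remQuot n y)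
    ; ~-sym    = boxAdj-sym
    ; ~-irrefl = λ { refl → boxAdj-irrefl refl }
    }

{-# OPTIONS --safe #-}

-- If S is a Γ-set of G all of whose vertices have external k-open private
-- neighbors, then S × V(H) is a minimal kTDS of G □ H: a vertex (g , h) sees the
-- copies of N(g) ∩ S in its own G-layer, and an external private neighbor v′ of v
-- yields the private neighbor (v′ , h) of (v , h), which has no neighbors from
-- S × V(H) in its H-layer because v′ ∉ S.  Its size is Γ(G) · |V(H)| ≥ Γ(G) · Γ(H).
module Submission where

open import Defs
open import Data.Fin using (Fin; zero; suc; combine; quotient)
open import Data.Fin.Properties
  using (suc-injective; remQuot-combine; combine-remQuot; combine-injectiveˡ)
open import Data.Fin.Subset
  using (Subset; inside; outside; _∈_; _∉_; _⊆_; _⊂_; _∩_; ∣_∣; _-_; ⊤; ⊥)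
open import Data.Fin.Subset.Properties
  using ( x∈p∩q⁺; x∈p∩q⁻; x∈p⇒∣p-x∣<∣p∣; x∈p∧x≢y⇒x∈p-y; p⊂q⇒∣p∣<∣q∣
        ; ∣p∣≤n; ∣⊤∣≡n; ∣⊥∣≡0)
open import Data.List.Extrema.Nat using (xs≤max; max≤v⁺)
import Data.List as List
import Data.List.Membership.Propositional as List
open import Data.List.Membership.Propositional.Properties
  using (∈-map⁺; ∈-filter⁺; ∈-cartesianProductWith⁺)
import Data.List.Relation.Unary.All as All
open import Data.List.Relation.Unary.All.Properties using () renaming (map⁺ to All-map⁺)
open import Data.List.Relation.Unary.Any using (here; there)
open import Data.Nat using (ℕ; _+_; _*_; _≤_; _≥_; z≤n)
open import Data.Nat.Properties
  using (≤-trans; ≤-<-trans; <-irrefl; *-monoʳ-≤; module ≤-Reasoning)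
open import Data.Product using (_×_; _,_; proj₁; proj₂; ∃-syntax)
open import Data.Sum using (inj₁; inj₂)
open import Data.Vec as Vec using ([]; _∷_; _++_; concat; replicate; lookup; here; there)
open import Data.Vec.Properties
  using ([]=⇒lookup; lookup⇒[]=; lookup∘tabulate; lookup-concat; lookup-map; lookup-replicate)
open import Function using (_∘_)
open import Relation.Binary.PropositionalEquality
  using (_≡_; refl; sym; trans; cong; cong₂; subst; subst₂; module ≡-Reasoning)
open import Relation.Nullary using (contradiction; yes; no)
open import Relation.Nullary.Decidable using (dec-true)

private
  variable
    k m n : ℕ

-- Induction on `p`. When `zero` belongs to `p`, its image is deleted from `q`: injectivity keeps
-- the images of the other elements inside `q - f zero`, and the deletion makes `q` strictly
-- smaller, which pays for the extra element of `p`.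
injectiveOn⇒∣p∣≤∣q∣ : (p : Subset m) (q : Subset n) (f : Fin m → Fin n) →
  (∀ {x} → x ∈ p → f x ∈ q) →
  (∀ {x y} → x ∈ p → y ∈ p → f x ≡ f y → x ≡ y) →
  ∣ p ∣ ≤ ∣ q ∣
injectiveOn⇒∣p∣≤∣q∣ []            q f f∈ inj = z≤n
injectiveOn⇒∣p∣≤∣q∣ (outside ∷ p) q f f∈ inj =
  injectiveOn⇒∣p∣≤∣q∣ p q (f ∘ suc) (f∈ ∘ there)
    λ x∈p y∈p → suc-injective ∘ inj (there x∈p) (there y∈p)
injectiveOn⇒∣p∣≤∣q∣ (inside ∷ p) q f f∈ inj =
  ≤-<-trans
    (injectiveOn⇒∣p∣≤∣q∣ p (q - f zero) (f ∘ suc)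
      (λ x∈p → x∈p∧x≢y⇒x∈p-y (f∈ (there x∈p))
        λ eq → contradiction (inj (there x∈p) here eq) λ ())
      λ x∈p y∈p → suc-injective ∘ inj (there x∈p) (there y∈p))
    (x∈p⇒∣p-x∣<∣p∣ (f∈ here))

∣p++q∣≡∣p∣+∣q∣ : (p : Subset m) (q : Subset n) → ∣ p ++ q ∣ ≡ ∣ p ∣ + ∣ q ∣
∣p++q∣≡∣p∣+∣q∣ []            q = refl
∣p++q∣≡∣p∣+∣q∣ (inside  ∷ p) q = cong ℕ.suc (∣p++q∣≡∣p∣+∣q∣ p q)
∣p++q∣≡∣p∣+∣q∣ (outside ∷ p) q = ∣p++q∣≡∣p∣+∣q∣ p q

-- S × Fin n, in the coding of pairs used by _□_.
cylinder : ∀ n → Subset m → Subset (m * n)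
cylinder n S = concat (Vec.map (replicate n) S)

∣cylinder∣ : ∀ n (S : Subset m) → ∣ cylinder n S ∣ ≡ ∣ S ∣ * n
∣cylinder∣ n []            = refl
∣cylinder∣ n (inside  ∷ S) = trans (∣p++q∣≡∣p∣+∣q∣ (⊤ {n}) (cylinder n S))
  (cong₂ _+_ (∣⊤∣≡n n) (∣cylinder∣ n S))
∣cylinder∣ n (outside ∷ S) = trans (∣p++q∣≡∣p∣+∣q∣ (⊥ {n}) (cylinder n S))
  (cong₂ _+_ (∣⊥∣≡0 n) (∣cylinder∣ n S))

lookup-cylinder : ∀ (S : Subset m) (g : Fin m) (h : Fin n) →
  lookup (cylinder n S) (combine g h) ≡ lookup S g
lookup-cylinder {n = n} S g h = begin
  lookup (cylinder n S) (combine g h)           ≡⟨ lookup-concat (Vec.map (replicate n) S) g h ⟩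
  lookup (lookup (Vec.map (replicate n) S) g) h ≡⟨ cong (λ r → lookup r h) (lookup-map g (replicate n) S) ⟩
  lookup (replicate n (lookup S g)) h           ≡⟨ lookup-replicate h (lookup S g) ⟩
  lookup S g                                    ∎
  where open ≡-Reasoning

∈-cylinder⁺ : ∀ {S : Subset m} {g} (h : Fin n) → g ∈ S → combine g h ∈ cylinder n S
∈-cylinder⁺ {S = S} {g} h g∈S =
  lookup⇒[]= _ _ (trans (lookup-cylinder S g h) ([]=⇒lookup g∈S))

∈-cylinder⁻ : ∀ {S : Subset m} {g} {h : Fin n} → combine g h ∈ cylinder n S → g ∈ S
∈-cylinder⁻ {S = S} {g} {h} gh∈ =
  lookup⇒[]= _ _ (trans (sym (lookup-cylinder S g h)) ([]=⇒lookup gh∈))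

quotient-combine : ∀ (g : Fin m) (h : Fin n) → quotient n (combine g h) ≡ g
quotient-combine g h = cong proj₁ (remQuot-combine g h)

-- `remQuot` is stuck on a variable vertex of the product. Matching on this view turns such a vertex
-- into a pair of coordinates, to which `remQuot-combine` applies.
data CombineView {m n : ℕ} : Fin (m * n) → Set where
  ⟨_,_⟩ : (g : Fin m) (h : Fin n) → CombineView (combine g h)

combineView : (x : Fin (m * n)) → CombineView {m} {n} x
combineView {m} {n} x = subst CombineView (combine-remQuot {m} n x) ⟨ _ , _ ⟩

module _ (G : Graph n) where
  open Graph G

  ∈-N⁺ : ∀ {x y} → x ~ y → y ∈ N G x
  ∈-N⁺ {x} {y} x~y = lookup⇒[]= y _ (trans (lookup∘tabulate _ y) (dec-true (x ~? y) x~y))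

  ∈-N⁻ : ∀ {x y} → y ∈ N G x → x ~ y
  -- Abstracting `x ~? y` also rewrites the type of the equation beside it, so the `no` case carries
  -- `false ≡ true`.
  ∈-N⁻ {x} {y} y∈N with x ~? y | trans (sym (lookup∘tabulate _ y)) ([]=⇒lookup y∈N)
  ... | yes x~y | _  = x~y
  ... | no _    | ()

module _ (G : Graph m) (H : Graph n) where
  open Graph (G □ H) using () renaming (_~_ to _~□_)

  □-adj⁺ : ∀ {g g′ h h′} → BoxAdj G H (g , h) (g′ , h′) → combine g h ~□ combine g′ h′
  □-adj⁺ = subst₂ (BoxAdj G H) (sym (remQuot-combine _ _)) (sym (remQuot-combine _ _))

  □-adj⁻ : ∀ {g g′ h h′} → combine g h ~□ combine g′ h′ → BoxAdj G H (g , h) (g′ , h′)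
  □-adj⁻ = subst₂ (BoxAdj G H) (remQuot-combine _ _) (remQuot-combine _ _)

  -- Only neighbors with second coordinate `h` are counted. If `g ∈ S`, the neighbors of `h` in `H`
  -- contribute further elements on the right, so equality can fail.
  ∣N∩S∣≤∣N∩cylinder∣ : ∀ S g h →
    ∣ N G g ∩ S ∣ ≤ ∣ N (G □ H) (combine g h) ∩ cylinder n S ∣
  ∣N∩S∣≤∣N∩cylinder∣ S g h = injectiveOn⇒∣p∣≤∣q∣ _ _ (λ a → combine a h) layer
    λ {a} {b} _ _ → combine-injectiveˡ a h b h
    where
    layer : ∀ {a} → a ∈ N G g ∩ S → combine a h ∈ N (G □ H) (combine g h) ∩ cylinder n S
    layer a∈ with a∈N , a∈S ← x∈p∩q⁻ (N G g) S a∈ =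
      x∈p∩q⁺ (∈-N⁺ (G □ H) (□-adj⁺ (inj₂ (refl , ∈-N⁻ G a∈N))) , ∈-cylinder⁺ h a∈S)

  external-layer : ∀ {S g} h → g ∉ S → ∀ {x} →
    x ∈ N (G □ H) (combine g h) ∩ cylinder n S →
    ∃[ a ] (x ≡ combine a h × a ∈ N G g ∩ S)
  external-layer {S} {g} h g∉S {x} x∈
    with ⟨ a , b ⟩ ← combineView {m} {n} x
    with x∈N , x∈C ← x∈p∩q⁻ (N (G □ H) (combine g h)) (cylinder n S) x∈
    with □-adj⁻ (∈-N⁻ (G □ H) x∈N)
  -- Along an edge of `H` the first coordinate stays `g`, so membership in the cylinder would force
  -- `g ∈ S`.
  ... | inj₁ (refl , _)   = contradiction (∈-cylinder⁻ {S = S} x∈C) g∉S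
  ... | inj₂ (refl , g~a) = a , refl , x∈p∩q⁺ (∈-N⁺ G g~a , ∈-cylinder⁻ {S = S} x∈C)

  -- Forgetting the second coordinate is injective here because `external-layer` fixes that
  -- coordinate to `h`.
  ∣N∩cylinder∣≤∣N∩S∣ : ∀ {S g} h → g ∉ S →
    ∣ N (G □ H) (combine g h) ∩ cylinder n S ∣ ≤ ∣ N G g ∩ S ∣
  ∣N∩cylinder∣≤∣N∩S∣ {S} {g} h g∉S =
    injectiveOn⇒∣p∣≤∣q∣ _ _ (quotient n) mapsTo injective
    where
    mapsTo : ∀ {x} → x ∈ N (G □ H) (combine g h) ∩ cylinder n S →
      quotient n x ∈ N G g ∩ S
    mapsTo x∈ with a , refl , a∈ ← external-layer h g∉S x∈ =
      subst (_∈ N G g ∩ S) (sym (quotient-combine a h)) a∈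

    injective : ∀ {x y} → x ∈ N (G □ H) (combine g h) ∩ cylinder n S →
      y ∈ N (G □ H) (combine g h) ∩ cylinder n S →
      quotient n x ≡ quotient n y → x ≡ y
    injective x∈ y∈ with external-layer h g∉S x∈ | external-layer h g∉S y∈
    ... | a , refl , _ | b , refl , _ = λ eq → cong (λ c → combine c h)
      (trans (sym (quotient-combine a h)) (trans eq (quotient-combine b h)))

  cylinder-isTDS : ∀ {S} → IsTDS k G S → IsTDS k (G □ H) (cylinder n S)
  cylinder-isTDS {S = S} tds x with ⟨ g , h ⟩ ← combineView {m} {n} x =
    ≤-trans (tds g) (∣N∩S∣≤∣N∩cylinder∣ S g h)

  cylinder-isMinimalTDS : ∀ {S} → IsTDS k G S →
    (∀ v → v ∈ S → ∃[ v′ ] IsExternalOpenPrivateNeighbor k G S v v′) →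
    IsMinimalTDS k (G □ H) (cylinder n S)
  cylinder-isMinimalTDS {k = k} {S} tds epn = cylinder-isTDS tds , minimal
    where
    minimal : ∀ T → T ⊂ cylinder n S → IsTDS k (G □ H) T → _
    minimal T (T⊆C , x , x∈C , x∉T) T-tds
      with ⟨ v , h ⟩ ← combineView {m} {n} x
      with v∈S ← ∈-cylinder⁻ {S = S} x∈C
      with v′ , (v∈Nv′ , ∣Nv′∩S∣≡k) , v′∉S ← epn v v∈S =
      -- `T` omits `combine v h`, which is a neighbor of `y` in the cylinder. Since `y` has at most
      -- `k` neighbors in the cylinder, fewer than `k` of them are left in `T`.
      <-irrefl refl (begin-strict
        k                      ≤⟨ T-tds y ⟩
        ∣ Ny ∩ T ∣             <⟨ p⊂q⇒∣p∣<∣q∣ (sub , combine v h , x∈Ny∩C , x∉T ∘ proj₂ ∘ x∈p∩q⁻ Ny T) ⟩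
        ∣ Ny ∩ cylinder n S ∣  ≤⟨ ∣N∩cylinder∣≤∣N∩S∣ h v′∉S ⟩
        ∣ N G v′ ∩ S ∣         ≡⟨ ∣Nv′∩S∣≡k ⟩
        k                      ∎)
      where
      open ≤-Reasoning
      y  = combine v′ h
      Ny = N (G □ H) y

      sub : Ny ∩ T ⊆ Ny ∩ cylinder n S
      sub z∈ with z∈N , z∈T ← x∈p∩q⁻ Ny T z∈ = x∈p∩q⁺ (z∈N , T⊆C z∈T)

      x∈Ny∩C : combine v h ∈ Ny ∩ cylinder n S
      x∈Ny∩C = x∈p∩q⁺ (∈-N⁺ (G □ H) (□-adj⁺ (inj₂ (refl , ∈-N⁻ G v∈Nv′))) , x∈C)

∈-allSubsets : (S : Subset n) → S List.∈ allSubsets n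
∈-allSubsets []      = here refl
∈-allSubsets (s ∷ S) = ∈-cartesianProductWith⁺ _∷_ (∈-sides s) (∈-allSubsets S)
  where
  ∈-sides : ∀ s → s List.∈ inside List.∷ outside List.∷ List.[]
  ∈-sides inside  = here refl
  ∈-sides outside = there (here refl)

∣minimalTDS∣≤Γ : ∀ (G : Graph n) {S} → IsMinimalTDS k G S → ∣ S ∣ ≤ Γ k G
∣minimalTDS∣≤Γ {k = k} G {S} min =
  All.lookup (xs≤max 0 _) (∈-map⁺ ∣_∣ (∈-filter⁺ (isMinimalTDS? k G) (∈-allSubsets S) min))

Γ≤n : ∀ k (G : Graph n) → Γ k G ≤ n
-- `z≤n` bounds the default value 0 of `max`; the entries of the list are bounded as cardinalities
-- of subsets of `Fin n`.
Γ≤n k G = max≤v⁺ z≤n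
  (All-map⁺ (All.universal ∣p∣≤n (List.filter (isMinimalTDS? k G) (allSubsets _))))

mainTheorem11 : ∀ (k : ℕ) → k ≥ 2 →
    ∀ {m : ℕ} (G : Graph m) → ΓExternal k G → δ G ≥ k →
    ∀ {n : ℕ} (H : Graph n) → δ H ≥ k →
    Γ k (G □ H) ≥ Γ k G * Γ k H
mainTheorem11 k _ G (S , ((tds , _) , ∣S∣≡Γ) , epn) _ {n} H _ = begin
  Γ k G * Γ k H    ≤⟨ *-monoʳ-≤ (Γ k G) (Γ≤n k H) ⟩
  Γ k G * n        ≡⟨ cong (_* n) ∣S∣≡Γ ⟨
  ∣ S ∣ * n         ≡⟨ ∣cylinder∣ n S ⟨
  ∣ cylinder n S ∣  ≤⟨ ∣minimalTDS∣≤Γ (G □ H) (cylinder-isMinimalTDS G H tds epn) ⟩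
  Γ k (G □ H)      ∎
  where open ≤-Reasoning
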